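{- Let $G$ be a signed digraph. If $G$ has at most one negative cycle, then $G$ is separating. If $G$ is strongly connected and has at most one negative cycle, then $G$ is trapping.
   Context: A signed digraph $G=(V,E)$ has finite vertex set $V$ and arcs $E\subseteq V\times V\times\{ -1,1\}$ ($(j,i,s)$: arc from $j$ to $i$ of sign $s$; loops and opposite-sign parallel arcs allowed). Cycles are simple subgraphs; sign = product of arc signs. Strong connectivity refers to the underlying unsigned digraph. A BN on $V$ is a map $f:\{0,1\}^V\to\{0,1\}^V$; $G(f)$ has a positive (negative) arc from $j$ to $i$ iff for some $x$ with $x_j=0$, $f_i(x+e_j)-f_i(x)$ is positive (negative) ($e_j$ = configuration equal to $1$ only at $j$, $+$ mod 2). $F(G)=\{f:G(f)=G\}$. $\Gamma(f)$ is the digraph on $\{0,1\}^V$ with arcs $x\to x+e_i$ whenever $f_i(x)\neq x_i$. A trap set has no outgoing arc; an attractor is an inclusion-minimal nonempty trap set. A subspace is $\{x: x_i=c(i)\ \forall i\in I\}$; $[X]$ is the smallest subspace containing $X$; a trap space is a subspace that is a trap set; $\langle X\rangle$ is the smallest trap space containing $X$. $\Gamma(f)$ is separating if $[A]\cap[B]=\emptyset$ for all distinct attractors $A,B$, and trapping if it is separating and $[A]=\langle A\rangle$ for every attractor $A$. $G$ is separating (trapping) if $\Gamma(f)$ is separating (trapping) for all $f\in F(G)$. -}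

module Defs where

open import Data.Nat using (ℕ; zero; suc)
open import Data.Fin using (Fin; zero; suc)
open import Data.Fin.Properties using () renaming (_≟_ to _≟ᶠ_)
open import Data.Bool using (Bool; true; false; not)
open import Data.Maybe using (Maybe; just; nothing)
open import Data.Vec using (Vec; lookup; updateAt)
open import Data.Product using (Σ; ∃; _×_; _,_)
open import Relation.Binary.PropositionalEquality using (_≡_; _≢_)
open import Relation.Nullary using (¬_)
open import Function.Bundles using (_⇔_)

data Sign : Set where
  pos neg : Sign

_·_ : Sign → Sign → Sign
pos · s = s
neg · pos = neg
neg · neg = pos

-- A signed digraph: E j i s ≡ true  iff  (j , i , s) is an arc (from j to i, sign s).
-- Loops and opposite-sign parallel arcs are allowed.
SignedDigraph : ℕ → Set
SignedDigraph n = Fin n → Fin n → Sign → Bool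

Arc : ∀ {n} → SignedDigraph n → Fin n → Fin n → Sign → Set
Arc G j i s = G j i s ≡ true

cyc : ∀ {k} → Fin (suc k) → Fin (suc k)
cyc {zero} zero = zero
cyc {suc k} zero = suc zero
cyc {suc k} (suc t) with cyc {k} t
... | zero = zero
... | suc u = suc (suc u)

prodSign : ∀ k → (Fin k → Sign) → Sign
prodSign zero s = pos
prodSign (suc k) s = s zero · prodSign k (λ t → s (suc t))

record Cycle {n : ℕ} (G : SignedDigraph n) : Set where
  field
    len   : ℕ
    verts : Fin (suc len) → Fin n
    signs : Fin (suc len) → Sign
    inj   : ∀ a b → verts a ≡ verts b → a ≡ b
    arcs  : ∀ t → Arc G (verts t) (verts (cyc t)) (signs t)

open Cycle public

cycleSign : ∀ {n} {G : SignedDigraph n} → Cycle G → Sign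
cycleSign C = prodSign (suc (len C)) (signs C)

ArcOf : ∀ {n} {G : SignedDigraph n} → Cycle G → Fin n → Fin n → Sign → Set
ArcOf C j i s = ∃ λ t → verts C t ≡ j × verts C (cyc t) ≡ i × signs C t ≡ s

SameCycle : ∀ {n} {G : SignedDigraph n} → Cycle G → Cycle G → Set
SameCycle C D = ∀ j i s → ArcOf C j i s ⇔ ArcOf D j i s

AtMostOneNegCycle : ∀ {n} → SignedDigraph n → Set
AtMostOneNegCycle G = ∀ (C D : Cycle G) → cycleSign C ≡ neg → cycleSign D ≡ neg → SameCycle C D

data Reach {n} (G : SignedDigraph n) (u : Fin n) : Fin n → Set where
  here : Reach G u u
  step : ∀ {w v} s → Reach G u w → Arc G w v s → Reach G u v

StronglyConnected : ∀ {n} → SignedDigraph n → Set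
StronglyConnected G = ∀ u v → Reach G u v

Config : ℕ → Set
Config n = Vec Bool n

BN : ℕ → Set
BN n = Config n → Config n

flip : ∀ {n} → Config n → Fin n → Config n
flip x i = updateAt x i not

InfArc : ∀ {n} → BN n → Fin n → Fin n → Sign → Set
InfArc f j i pos = ∃ λ x → lookup x j ≡ false × lookup (f x) i ≡ false × lookup (f (flip x j)) i ≡ true
InfArc f j i neg = ∃ λ x → lookup x j ≡ false × lookup (f x) i ≡ true × lookup (f (flip x j)) i ≡ false

InF : ∀ {n} → SignedDigraph n → BN n → Set
InF G f = ∀ j i s → Arc G j i s ⇔ InfArc f j i s

CSet : ℕ → Set
CSet n = Config n → Bool

_∈ₛ_ : ∀ {n} → Config n → CSet n → Set
x ∈ₛ A = A x ≡ true

_⊆ₛ_ : ∀ {n} → CSet n → CSet n → Set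
A ⊆ₛ B = ∀ x → x ∈ₛ A → x ∈ₛ B

_≐ₛ_ : ∀ {n} → CSet n → CSet n → Set
A ≐ₛ B = ∀ x → A x ≡ B x

-- Γ(f) has an arc x → flip x i whenever f_i(x) ≠ x_i; a trap set has no outgoing arc
-- (stated for an arbitrary membership predicate P)
IsTrap : ∀ {n} → BN n → (Config n → Set) → Set
IsTrap f P = ∀ x i → P x → lookup (f x) i ≢ lookup x i → P (flip x i)

TrapSet : ∀ {n} → BN n → CSet n → Set
TrapSet f A = IsTrap f (λ x → x ∈ₛ A)

Nonempty : ∀ {n} → CSet n → Set
Nonempty A = ∃ λ x → x ∈ₛ A

Attractor : ∀ {n} → BN n → CSet n → Set
Attractor f A = Nonempty A × TrapSet f A ×
  (∀ B → Nonempty B → TrapSet f B → B ⊆ₛ A → A ⊆ₛ B)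

-- subspaces: c i ≡ just b fixes coordinate i to b, nothing leaves it free
Subspace : ℕ → Set
Subspace n = Vec (Maybe Bool) n

_∈ₚ_ : ∀ {n} → Config n → Subspace n → Set
x ∈ₚ S = ∀ i b → lookup S i ≡ just b → lookup x i ≡ b

_⊆ₚ_ : ∀ {n} → Subspace n → Subspace n → Set
S ⊆ₚ T = ∀ x → x ∈ₚ S → x ∈ₚ T

TrapSpace : ∀ {n} → BN n → Subspace n → Set
TrapSpace f S = IsTrap f (λ x → x ∈ₚ S)

IsSpan : ∀ {n} → CSet n → Subspace n → Set
IsSpan X S = (∀ x → x ∈ₛ X → x ∈ₚ S) × (∀ T → (∀ x → x ∈ₛ X → x ∈ₚ T) → S ⊆ₚ T)

IsTrapSpan : ∀ {n} → BN n → CSet n → Subspace n → Set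
IsTrapSpan f X S = TrapSpace f S × (∀ x → x ∈ₛ X → x ∈ₚ S) ×
  (∀ T → TrapSpace f T → (∀ x → x ∈ₛ X → x ∈ₚ T) → S ⊆ₚ T)

SeparatingΓ : ∀ {n} → BN n → Set
SeparatingΓ f = ∀ A B → Attractor f A → Attractor f B → ¬ (A ≐ₛ B) →
  ∀ S T → IsSpan A S → IsSpan B T → ∀ x → ¬ (x ∈ₚ S × x ∈ₚ T)

TrappingΓ : ∀ {n} → BN n → Set
TrappingΓ f = SeparatingΓ f ×
  (∀ A → Attractor f A → ∀ S T → IsSpan A S → IsTrapSpan f A T → S ⊆ₚ T × T ⊆ₚ S)

SeparatingG : ∀ {n} → SignedDigraph n → Set
SeparatingG G = ∀ f → InF G f → SeparatingΓ f

TrappingG : ∀ {n} → SignedDigraph n → Set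
TrappingG G = ∀ f → InF G f → TrappingΓ f

{-# OPTIONS --safe #-}
module Submission where

-- A negative closed walk contains a negative cycle, so it uses every arc of the unique one, C.
-- In a strong component containing C this yields an arc of C whose removal leaves a balanced
-- digraph: take any arc j → i of C; if some vertex is reached from i with both signs while
-- avoiding that arc, the first arc of C entering the set of such vertices works.
-- After switching signs, f is thus monotone on the component except along one arc. For an
-- attractor A, a maximal configuration of A lying below its image under the monotone upper
-- envelope of f is either fixed or the top of an invariant down-set; dually for minimal ones.
-- So A is a fixed point or spans an invariant interval, which gives the trapping property, and
-- two attractors with intersecting spans are forced to share an extreme configuration.
-- Without strong connectivity, components are added one at a time to a closed set U: before
-- the component of C is reached the attractors are constant on U, and afterwards components
-- are monotone with the configuration on U ranging over the same set for both attractors.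
-- The conclusions are stable under double negation, so the reasoning is classical throughout.

open import Defs
open import Data.Bool using (Bool; true; false; not; _∧_; _∨_; _xor_)
open import Data.Bool.Properties using (¬-not; not-¬; not-involutive) renaming (_≟_ to _≟ᵇ_)
open import Data.Empty using (⊥-elim)
open import Data.Fin using (Fin; zero; suc; inject₁; fromℕ)
open import Data.Fin.Properties using (_≟_)
open import Data.Maybe using (just; nothing)
open import Data.Maybe.Properties using (just-injective)
open import Data.Nat using (ℕ; zero; suc; _<_; _≤_; z≤n; s≤s)
open import Data.Nat.Induction using (<-wellFounded)
open import Data.Nat.Properties using (m≤n⇒m≤1+n; <-≤-trans)
open import Data.Product using (Σ; ∃; _×_; _,_; proj₁; proj₂)
open import Data.Product.Properties using (≡-dec)
open import Data.Sum using (_⊎_; inj₁; inj₂; map₂; [_,_]′)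
open import Data.Unit using (⊤; tt)
open import Data.Vec using ([]; _∷_; lookup; replicate; _[_]≔_)
open import Data.Vec.Properties using (lookup∘updateAt; lookup∘updateAt′; lookup∘update; lookup∘update′; lookup-replicate)
open import Function using (_∘_)
open import Function.Bundles using (module Equivalence)
open import Induction.WellFounded using (Acc; acc)
open import Relation.Binary.PropositionalEquality using (_≡_; _≢_; refl; sym; trans; cong; cong₂; subst; ≢-sym)
open import Relation.Nullary using (¬_; Dec; yes; no; contradiction)
open import Relation.Nullary.Decidable using (decidable-stable)

private variable
  n : ℕ

-- Classical reasoning under double negation

infixl 1 _>>=_

_>>=_ : {A B : Set} → ¬ ¬ A → (A → ¬ ¬ B) → ¬ ¬ B
(m >>= k) z = m λ a → k a z

return : {A : Set} → A → ¬ ¬ A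
return a z = z a

em : (A : Set) → ¬ ¬ (A ⊎ ¬ A)
em A z = z (inj₂ λ a → z (inj₁ a))

bool-stable : {a b : Bool} → ¬ ¬ (a ≡ b) → a ≡ b
bool-stable = decidable-stable (_ ≟ᵇ _)

-- Finiteness of the index makes this double-negation shift provable; it lets a classical choice be
-- made for all vertices at once.
fin-shift : {P : Fin n → Set} → (∀ i → ¬ ¬ P i) → ¬ ¬ (∀ i → P i)
fin-shift {zero} h = return λ ()
fin-shift {suc n} h = do
  p ← h zero
  ps ← fin-shift (λ i → h (suc i))
  return λ { zero → p ; (suc i) → ps i }

config-shift : {P : Config n → Set} → (∀ x → ¬ ¬ P x) → ¬ ¬ (∀ x → P x)
config-shift {zero} h = do
  p ← h []
  return λ { [] → p }
config-shift {suc n} h = do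
  p ← config-shift (λ x → h (true ∷ x))
  q ← config-shift (λ x → h (false ∷ x))
  return λ { (true ∷ x) → p x ; (false ∷ x) → q x }

Decides : Bool → Set → Set
Decides b P = (b ≡ true → P) × (P → b ≡ true)

decide : (P : Set) → ¬ ¬ ∃ λ b → Decides b P
decide P = do
  inj₁ p ← em P
    where inj₂ ¬p → return (false , (λ ()) , λ p → contradiction p ¬p)
  return (true , (λ _ → p) , λ _ → refl)

fin-decide : (P : Fin n → Set) → ¬ ¬ ∃ λ (g : Fin n → Bool) → ∀ i → Decides (g i) (P i)
fin-decide P = do
  h ← fin-shift (λ i → decide (P i))
  return ((λ i → proj₁ (h i)) , λ i → proj₂ (h i))

-- `CSet` is Boolean-valued, so a predicate needs a characteristic function before the minimality
-- clause of `Attractor` can be applied to it.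
config-decide : (P : Config n → Set) → ¬ ¬ ∃ λ (A : CSet n) → ∀ x → Decides (A x) (P x)
config-decide P = do
  h ← config-shift (λ x → decide (P x))
  return ((λ x → proj₁ (h x)) , λ x → proj₂ (h x))

minimal : {X : Set} (μ : X → ℕ) (P : X → Set) → ∃ P →
  ¬ ¬ ∃ λ x → P x × (∀ y → P y → ¬ (μ y < μ x))
minimal μ P (x , px) = go x (<-wellFounded (μ x)) px
  where
  go : ∀ x → Acc _<_ (μ x) → P x → ¬ ¬ ∃ λ x → P x × (∀ y → P y → ¬ (μ y < μ x))
  go x (acc rs) px = do
    inj₁ (y , py , lt) ← em (∃ λ y → P y × μ y < μ x)
      where inj₂ none → return (x , px , λ y py lt → none (y , py , lt))
    go y (rs lt) py

count : (Fin n → Bool) → ℕ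
count {zero} g = 0
count {suc n} g with g zero
... | true = suc (count (g ∘ suc))
... | false = count (g ∘ suc)

count-mono : (g h : Fin n → Bool) → (∀ k → g k ≡ true → h k ≡ true) → count g ≤ count h
count-mono {zero} g h g⊆h = z≤n
count-mono {suc n} g h g⊆h with g zero in eg | h zero in eh
... | true  | true  = s≤s (count-mono (g ∘ suc) (h ∘ suc) (g⊆h ∘ suc))
... | true  | false = contradiction (trans (sym eh) (g⊆h zero eg)) λ ()
... | false | true  = m≤n⇒m≤1+n (count-mono (g ∘ suc) (h ∘ suc) (g⊆h ∘ suc))
... | false | false = count-mono (g ∘ suc) (h ∘ suc) (g⊆h ∘ suc)

count-strict : (g h : Fin n → Bool) → (∀ k → g k ≡ true → h k ≡ true) →
  ∀ k → g k ≡ false → h k ≡ true → count g < count h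
count-strict {suc n} g h g⊆h k gk hk with g zero in eg | h zero in eh
... | true  | false = contradiction (trans (sym eh) (g⊆h zero eg)) λ ()
count-strict {suc n} g h g⊆h zero gk hk | true | true = contradiction (trans (sym eg) gk) λ ()
count-strict {suc n} g h g⊆h (suc k) gk hk | true | true =
  s≤s (count-strict (g ∘ suc) (h ∘ suc) (g⊆h ∘ suc) k gk hk)
count-strict {suc n} g h g⊆h k gk hk | false | true = s≤s (count-mono (g ∘ suc) (h ∘ suc) (g⊆h ∘ suc))
count-strict {suc n} g h g⊆h zero gk hk | false | false = contradiction (trans (sym eh) hk) λ ()
count-strict {suc n} g h g⊆h (suc k) gk hk | false | false =
  count-strict (g ∘ suc) (h ∘ suc) (g⊆h ∘ suc) k gk hk

∧-intro : ∀ {a b} → a ≡ true → b ≡ true → a ∧ b ≡ true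
∧-intro refl refl = refl

∧-elim : ∀ {a b} → a ∧ b ≡ true → a ≡ true × b ≡ true
∧-elim {true} {true} _ = refl , refl

∨-elim : ∀ {a b} → a ∨ b ≡ true → a ≡ true ⊎ b ≡ true
∨-elim {true} _ = inj₁ refl
∨-elim {false} e = inj₂ e

∨-introˡ : ∀ {a b} → a ≡ true → a ∨ b ≡ true
∨-introˡ refl = refl

∨-introʳ : ∀ {a b} → b ≡ true → a ∨ b ≡ true
∨-introʳ {true} _ = refl
∨-introʳ {false} e = e

xor-true : ∀ {a b} → a xor b ≡ true → a ≢ b
xor-true {true} {true} ()
xor-true {false} {false} ()
xor-true {true} {false} _ ()
xor-true {false} {true} _ ()

xor-≢ : ∀ {a b} → a ≢ b → a xor b ≡ true
xor-≢ {true} {true} ne = contradiction refl ne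
xor-≢ {false} {false} ne = contradiction refl ne
xor-≢ {true} {false} _ = refl
xor-≢ {false} {true} _ = refl

-- Signs

_≟ˢ_ : (s p : Sign) → Dec (s ≡ p)
pos ≟ˢ pos = yes refl
pos ≟ˢ neg = no λ ()
neg ≟ˢ pos = no λ ()
neg ≟ˢ neg = yes refl

sign-stable : {s p : Sign} → ¬ ¬ (s ≡ p) → s ≡ p
sign-stable = decidable-stable (_ ≟ˢ _)

≢neg⇒≡pos : ∀ {s} → s ≢ neg → s ≡ pos
≢neg⇒≡pos {pos} _ = refl
≢neg⇒≡pos {neg} h = contradiction refl h

·-assoc : ∀ s p q → (s · p) · q ≡ s · (p · q)
·-assoc pos p q = refl
·-assoc neg pos q = refl
·-assoc neg neg pos = refl
·-assoc neg neg neg = refl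

·-identityʳ : ∀ s → s · pos ≡ s
·-identityʳ pos = refl
·-identityʳ neg = refl

·-cancelʳ : ∀ s p q → s · q ≡ p · q → s ≡ p
·-cancelʳ pos pos q _ = refl
·-cancelʳ neg neg q _ = refl
·-cancelʳ pos neg pos ()
·-cancelʳ pos neg neg ()
·-cancelʳ neg pos pos ()
·-cancelʳ neg pos neg ()

·-comm : ∀ s p → s · p ≡ p · s
·-comm pos pos = refl
·-comm pos neg = refl
·-comm neg pos = refl
·-comm neg neg = refl

·≡pos : ∀ s p → s · p ≡ pos → s ≡ p
·≡pos pos pos _ = refl
·≡pos neg neg _ = refl

neg·≢ : ∀ s → neg · s ≢ s
neg·≢ pos ()
neg·≢ neg ()

·-cancel-middle : ∀ p s → (neg · (p · s)) · p ≡ neg · s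
·-cancel-middle pos s = ·-identityʳ (neg · s)
·-cancel-middle neg pos = refl
·-cancel-middle neg neg = refl

act : Sign → Bool → Bool
act pos b = b
act neg b = not b

act-· : ∀ s p b → act (s · p) b ≡ act p (act s b)
act-· pos p b = refl
act-· neg pos b = refl
act-· neg neg b = sym (not-involutive b)

act-not : ∀ s b → act s (not b) ≡ not (act s b)
act-not pos b = refl
act-not neg b = refl

-- Walks

ArcRel : ℕ → Set₁
ArcRel n = Fin n → Fin n → Sign → Set

data Walk (R : ArcRel n) : Fin n → Fin n → Sign → Set where
  nil  : ∀ {u} → Walk R u u pos
  cons : ∀ {u w v s p} → R u w s → Walk R w v p → Walk R u v (s · p)

private variable
  R R′ : ArcRel n
  u v w x : Fin n
  s p q : Sign

walk-map : (∀ {j i s} → R j i s → R′ j i s) → Walk R u v s → Walk R′ u v s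
walk-map h nil = nil
walk-map h (cons a W) = cons (h a) (walk-map h W)

_++_ : Walk R u v s → Walk R v w p → Walk R u w (s · p)
nil ++ W = W
cons {s = s} {p} a V ++ W = subst (Walk _ _ _) (sym (·-assoc s p _)) (cons a (V ++ W))

[_]ʷ : R u v s → Walk R u v s
[_]ʷ {s = s} a = subst (Walk _ _ _) (·-identityʳ s) (cons a nil)

NegClosed : ArcRel n → Set
NegClosed R = ∃ λ u → Walk R u u neg

closed-pos : ¬ NegClosed R → Walk R u u s → s ≡ pos
closed-pos none W = ≢neg⇒≡pos λ { refl → none (_ , W) }

_∉_ : {R : ArcRel n} → Fin n → Walk R u v s → Set
_∉_ {u = u} x nil = x ≢ u
_∉_ {u = u} x (cons _ W) = x ≢ u × x ∉ W

Simple : Walk R u v s → Set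
Simple nil = ⊤
Simple {u = u} (cons _ W) = u ∉ W × Simple W

end-∈ : (W : Walk R u v s) → ¬ (v ∉ W)
end-∈ nil h = h refl
end-∈ (cons _ W) h = end-∈ W (proj₂ h)

-- The last component, that `W₁` visits only vertices of `W`, is what keeps `cons a W₁` simple in
-- the recursive case.
split-at : ∀ x (W : Walk R u v s) → Simple W → x ∉ W ⊎
  ∃ λ p → ∃ λ q → Σ (Walk R u x p) λ W₁ → Σ (Walk R x v q) λ W₂ →
    Simple W₁ × Simple W₂ × s ≡ p · q × (∀ y → y ∉ W → y ∉ W₁)
split-at {u = u} x nil sm with x ≟ u
... | yes refl = inj₂ (pos , pos , nil , nil , tt , tt , refl , λ y h → h)
... | no x≢u = inj₁ x≢u
split-at {u = u} x (cons {s = s} a W) (u∉W , sm) with x ≟ u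
... | yes refl = inj₂ (pos , _ , nil , cons a W , tt , (u∉W , sm) , refl , λ y h → proj₁ h)
... | no x≢u with split-at x W sm
...   | inj₁ x∉W = inj₁ (x≢u , x∉W)
...   | inj₂ (p , q , W₁ , W₂ , sm₁ , sm₂ , refl , sub) =
        inj₂ (s · p , q , cons a W₁ , W₂ , (sub _ u∉W , sm₁) , sm₂ , sym (·-assoc s p q)
             , λ y h → proj₁ h , sub y (proj₂ h))

NegSimple : ArcRel n → Set
NegSimple R = ∃ λ u → ∃ λ w → ∃ λ s → ∃ λ p →
  R u w s × Σ (Walk R w u p) Simple × p · s ≡ neg

-- Loop erasure: every erased loop is positive unless a negative simple cycle is met.
erase : Walk R u v s → NegSimple R ⊎ Σ (Walk R u v s) Simple
erase nil = inj₂ (nil , tt)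
erase {R = R} {u = u} {v = v} (cons {s = s} a W) with erase W
... | inj₁ c = inj₁ c
... | inj₂ (W′ , sm) with split-at u W′ sm
...   | inj₁ u∉W′ = inj₂ (cons a W′ , u∉W′ , sm)
...   | inj₂ (p , q , W₁ , W₂ , sm₁ , sm₂ , refl , _) with (s · p) in eq
...     | neg = inj₁ (_ , _ , s , p , a , (W₁ , sm₁) , trans (·-comm p s) eq)
...     | pos = inj₂ (subst (λ r → Σ (Walk R u v r) Simple)
                  (trans (cong (_· q) (sym eq)) (·-assoc s p q)) (W₂ , sm₂))

neg-simple : Walk R u u s → s ≡ neg → NegSimple R
neg-simple W eq with erase W
... | inj₁ c = c
neg-simple W () | inj₂ (nil , _)
neg-simple W eq | inj₂ (cons a W′ , u∉W′ , _) = contradiction u∉W′ (end-∈ W′)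

size : Walk R u v s → ℕ
size nil = 0
size (cons _ W) = suc (size W)

vertex : {R : ArcRel n} (W : Walk R u v s) → Fin (suc (size W)) → Fin n
vertex {u = u} W zero = u
vertex (cons _ W) (suc t) = vertex W t

-- closedSign W r and next W x describe W followed by one more arc, of sign r and head x.
closedSign : (W : Walk R u v s) → Sign → Fin (suc (size W)) → Sign
closedSign nil r zero = r
closedSign (cons {s = s} _ W) r zero = s
closedSign (cons _ W) r (suc t) = closedSign W r t

next : {R : ArcRel n} (W : Walk R u v s) → Fin n → Fin (suc (size W)) → Fin n
next nil x zero = x
next (cons _ W) x zero = vertex W zero
next (cons _ W) x (suc t) = next W x t

closed-arc : (W : Walk R u v s) → R v x p → ∀ t → R (vertex W t) (next W x t) (closedSign W p t)
closed-arc nil b zero = b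
closed-arc (cons a W) b zero = a
closed-arc (cons a W) b (suc t) = closed-arc W b t

-- The closing vertex `x` is independent of the start of `W`, since in the recursion the start moves
-- along the walk while `x` stays put.
next-cyc : {R : ArcRel n} (W : Walk R u v s) (x : Fin n) → ∀ t →
  (cyc t ≡ zero × next W x t ≡ x) ⊎ ∃ λ t′ → cyc t ≡ suc t′ × next W x t ≡ vertex W (suc t′)
next-cyc nil x zero = inj₁ (refl , refl)
next-cyc (cons a W) x zero = inj₂ (zero , refl , refl)
next-cyc (cons a W) x (suc t) with cyc t | next-cyc W x t
... | zero | inj₁ (refl , e) = inj₁ (refl , e)
... | suc t′ | inj₂ (.t′ , refl , e) = inj₂ (suc t′ , refl , e)

next-closed : (W : Walk R u v s) → ∀ t → next W u t ≡ vertex W (cyc t)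
next-closed {u = u} W t with cyc t | next-cyc W u t
... | zero | inj₁ (_ , e) = e
... | suc t′ | inj₂ (.t′ , refl , e) = e

closedSign-prod : (W : Walk R u v s) → ∀ r → prodSign _ (closedSign W r) ≡ s · r
closedSign-prod nil r = ·-identityʳ r
closedSign-prod (cons {s = s} {p} a W) r =
  trans (cong (s ·_) (closedSign-prod W r)) (sym (·-assoc s p r))

∉-vertex : {R : ArcRel n} (W : Walk R u v s) → x ∉ W → ∀ t → x ≢ vertex W t
∉-vertex nil h zero = h
∉-vertex (cons _ W) h zero = proj₁ h
∉-vertex (cons _ W) h (suc t) = ∉-vertex W (proj₂ h) t

vertex-inj : (W : Walk R u v s) → Simple W → ∀ a b → vertex W a ≡ vertex W b → a ≡ b
vertex-inj W sm zero zero e = refl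
vertex-inj (cons _ W) (u∉W , _) zero (suc b) e = contradiction e (∉-vertex W u∉W b)
vertex-inj (cons _ W) (u∉W , _) (suc a) zero e = contradiction (sym e) (∉-vertex W u∉W a)
vertex-inj (cons _ W) (_ , sm) (suc a) (suc b) e = cong suc (vertex-inj W sm a b e)

neg-cycle : {G : SignedDigraph n} → (∀ {j i s} → R j i s → Arc G j i s) → NegClosed R →
  ∃ λ (C : Cycle G) → cycleSign C ≡ neg × (∀ {j i s} → ArcOf C j i s → R j i s)
neg-cycle {R = R} {G = G} R⊆G (_ , W) with neg-simple W refl
... | u , w , s , p , a , (P , sm) , eq = C , trans (closedSign-prod P s) eq , inside
  where
  arc : ∀ t → R (vertex P t) (vertex P (cyc t)) (closedSign P s t)
  arc t = subst (λ y → R (vertex P t) y (closedSign P s t)) (next-closed P t) (closed-arc P a t)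

  C : Cycle G
  C = record { len = size P ; verts = vertex P ; signs = closedSign P s
             ; inj = vertex-inj P sm ; arcs = λ t → R⊆G (arc t) }

  inside : ∀ {j i s} → ArcOf C j i s → R j i s
  inside (t , refl , refl , refl) = arc t

cyc-inject₁ : ∀ {k} (t : Fin k) → cyc (inject₁ t) ≡ suc t
cyc-inject₁ {suc k} zero = refl
cyc-inject₁ {suc k} (suc t) rewrite cyc-inject₁ t = refl

cyc-fromℕ : ∀ k → cyc (fromℕ k) ≡ zero
cyc-fromℕ zero = refl
cyc-fromℕ (suc k) rewrite cyc-fromℕ k = refl

walk-along : ∀ {k} (g : Fin (suc k) → Fin n) → (∀ t → ∃ λ s → R (g (inject₁ t)) (g (suc t)) s) →
  ∃ λ s → Walk R (g zero) (g (fromℕ k)) s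
walk-along {k = zero} g h = pos , nil
walk-along {k = suc k} g h =
  let s , a = h zero
      p , W = walk-along (g ∘ suc) (h ∘ suc)
  in s · p , cons a W

cycle-walk : {G : SignedDigraph n} (C : Cycle G) → ∃ λ j → ∃ λ i → ∃ λ s → ∃ λ p →
  ArcOf C j i s × Walk (ArcOf C) i j p
cycle-walk C =
  let p , W = walk-along {R = ArcOf C} (verts C)
                (λ t → _ , inject₁ t , refl , cong (verts C) (cyc-inject₁ t) , refl)
  in _ , _ , _ , p , (fromℕ (len C) , refl , cong (verts C) (cyc-fromℕ (len C)) , refl) , W

-- Signed digraphs with a unique negative cycle

_∖_ : ArcRel n → Fin n × Fin n × Sign → ArcRel n
(R ∖ a) j i s = R j i s × (j , i , s) ≢ a

_≟ᵃ_ : (a b : Fin n × Fin n × Sign) → Dec (a ≡ b)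
_≟ᵃ_ = ≡-dec _≟_ (≡-dec _≟_ _≟ˢ_)

split-first : ∀ j i σ → Walk R u v s → Walk (R ∖ (j , i , σ)) u v s ⊎
  ∃ λ p → ∃ λ q → Walk (R ∖ (j , i , σ)) u j p × Walk R i v q × s ≡ p · (σ · q)
split-first j i σ nil = inj₁ nil
split-first j i σ (cons {u} {w} {s = s} a W) with (u , w , s) ≟ᵃ (j , i , σ)
... | yes refl = inj₂ (pos , _ , nil , W , refl)
... | no ne with split-first j i σ W
...   | inj₁ W′ = inj₁ (cons (a , ne) W′)
...   | inj₂ (p , q , W₁ , W₂ , refl) =
        inj₂ (s · p , q , cons (a , ne) W₁ , W₂ , sym (·-assoc s p (σ · q)))

split-last : ∀ j i σ → Walk R u v s → Walk (R ∖ (j , i , σ)) u v s ⊎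
  ∃ λ p → ∃ λ q → Walk R u j p × R j i σ × Walk (R ∖ (j , i , σ)) i v q × s ≡ p · (σ · q)
split-last j i σ nil = inj₁ nil
split-last j i σ (cons {u} {w} {s = s} a W) with split-last j i σ W
... | inj₂ (p , q , W₁ , b , W₂ , refl) =
      inj₂ (s · p , q , cons a W₁ , b , W₂ , sym (·-assoc s p (σ · q)))
... | inj₁ W′ with (u , w , s) ≟ᵃ (j , i , σ)
...   | yes refl = inj₂ (pos , _ , nil , a , W′ , refl)
...   | no ne = inj₁ (cons (a , ne) W′)

walk-to-tail : ∀ j i σ → Walk R u j s → ∃ λ p → Walk (R ∖ (j , i , σ)) u j p
walk-to-tail j i σ W with split-first j i σ W
... | inj₁ W′ = _ , W′
... | inj₂ (p , _ , W₁ , _) = p , W₁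

walk-from-head : ∀ j i σ → Walk R i v s → ∃ λ p → Walk (R ∖ (j , i , σ)) i v p
walk-from-head j i σ W with split-last j i σ W
... | inj₁ W′ = _ , W′
... | inj₂ (_ , q , _ , _ , W₂ , _) = q , W₂

Critical : ArcRel n → ArcRel n
Critical R j i s = R j i s × ¬ NegClosed (R ∖ (j , i , s))

Connected : ArcRel n → (Fin n → Set) → Set
Connected R Q = ∀ {u v} → Q u → Q v → ¬ ¬ ∃ (Walk R u v)

first-crossing : (P : Fin n → Set) → Walk R u v s → ¬ P u → P v →
  ¬ ¬ ∃ λ j → ∃ λ i → ∃ λ σ → R j i σ × ¬ P j × P i
first-crossing P nil ¬Pu Pv = contradiction Pv ¬Pu
first-crossing P (cons {w = w} a W) ¬Pu Pv = do
  inj₁ Pw ← em (P w)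
    where inj₂ ¬Pw → first-crossing P W ¬Pw Pv
  return (_ , _ , _ , a , ¬Pu , Pw)

both-signs : Walk R u v p → Walk R u v q → p ≢ q → ∀ s → Walk R u v s
both-signs {p = pos} {pos} _ _ ne = contradiction refl ne
both-signs {p = neg} {neg} _ _ ne = contradiction refl ne
both-signs {p = pos} {neg} W W′ _ pos = W
both-signs {p = pos} {neg} W W′ _ neg = W′
both-signs {p = neg} {pos} W W′ _ pos = W′
both-signs {p = neg} {pos} W W′ _ neg = W

-- Deleting a critical arc leaves no negative closed walk, yet possibly no strong connection either,
-- so a switching that balances the rest need not exist. Equal signs of the return walks from `i` to
-- `j` supply the missing condition.
Rigid : ArcRel n → ArcRel n
Rigid R j i σ = R j i σ × (∀ p q →
  Walk (R ∖ (j , i , σ)) i j p → Walk (R ∖ (j , i , σ)) i j q → p ≡ q)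

module _ {R : ArcRel n} {j i : Fin n} {σ : Sign} (crit : Critical R j i σ) where

  private
    a = (j , i , σ)

    Bad : Fin n → Set
    Bad u = ∀ s → Walk (R ∖ a) i u s

    good-unique : ¬ Bad u → Walk (R ∖ a) i u p → Walk (R ∖ a) i u q → p ≡ q
    good-unique ¬bad W W′ = sign-stable λ ne → ¬bad (both-signs W W′ ne)

    bad-step : Bad u → Walk (R ∖ a) u v s → Bad v
    bad-step {s = pos} bad W p = subst (Walk _ _ _) (·-identityʳ p) (bad p ++ W)
    bad-step {s = neg} bad W pos = bad neg ++ W
    bad-step {s = neg} bad W neg = bad pos ++ W

  -- W must use a; the part of W up to its last use of a, followed by a walk from i to
  -- i′ that avoids both a and a′, is closed and avoids a′, hence is positive.
  crossing-sign : ∀ {j′ i′ σ′} → Critical R j′ i′ σ′ → ¬ Bad j′ → Bad i′ →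
    Walk (R ∖ (j′ , i′ , σ′)) i′ j′ p → p ≡ neg · σ′
  crossing-sign {j′ = j′} {i′} {σ′} crit′ good bad W with split-last j i σ W
  ... | inj₁ W′ = contradiction (bad-step bad (walk-map (λ ((r , _) , ne) → r , ne) W′)) good
  ... | inj₂ (p₁ , p₂ , W₁ , b , W₂ , refl)
    -- `Bad i′` offers a walk of either sign; the sign taken is opposite to that of `W₂` continued
    -- by the second arc, which rules out that the walk uses this arc.
    with split-first j′ i′ σ′ (bad (neg · (p₂ · σ′)))
  ...   | inj₂ (q₁ , q₂ , Z₁ , Z₂ , eq) = contradiction (trans eq regular) (neg·≢ (p₂ · σ′))
    where
    regular : q₁ · (σ′ · q₂) ≡ p₂ · σ′
    regular with closed-pos (proj₂ crit) Z₂
    ... | refl = cong₂ _·_ (good-unique good (walk-map proj₁ Z₁)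
                   (walk-map (λ ((r , _) , ne) → r , ne) W₂)) (·-identityʳ σ′)
  ...   | inj₁ Z = trans (sym (·-assoc p₁ σ p₂))
          (trans (cong (_· p₂) (·≡pos (p₁ · σ) _ positive)) (·-cancel-middle p₂ σ′))
    where
    positive : (p₁ · σ) · (neg · (p₂ · σ′)) ≡ pos
    positive = closed-pos (proj₂ crit′)
      ((W₁ ++ [ b ]ʷ) ++ walk-map (λ ((r , _) , ne) → r , ne) Z)

  -- If `j` is good, the given arc is rigid. Otherwise `D` leads to the bad `j` from `i`, which is
  -- good because a bad `i` would carry a negative closed walk avoiding the arc; the arc where `D`
  -- enters `Bad` is rigid by `crossing-sign`.
  rigid-exists : Walk (Critical R) i j p → ¬ ¬ ∃ λ j′ → ∃ λ i′ → ∃ λ σ′ → Rigid R j′ i′ σ′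
  rigid-exists D = do
    inj₁ bad-j ← em (Bad j)
      where inj₂ good-j → return (j , i , σ , proj₁ crit , λ _ _ W W′ → good-unique good-j W W′)
    (j′ , i′ , σ′ , crit′ , good , bad) ← first-crossing Bad D
      (λ bad-i → proj₂ crit (i , bad-i neg)) bad-j
    return (j′ , i′ , σ′ , proj₁ crit′ , λ _ _ W W′ →
      trans (crossing-sign crit′ good bad W) (sym (crossing-sign crit′ good bad W′)))

potential : (R : ArcRel n) (Q : Fin n → Set) (i : Fin n) →
  (∀ {j i s} → R j i s → Q j × Q i) →
  (∀ {u} → Q u → ¬ ¬ ∃ (Walk R i u)) →
  (∀ {u p q} → Q u → Walk R i u p → Walk R i u q → p ≡ q) →
  ¬ ¬ ∃ λ (t : Fin n → Bool) → ∀ {u v s} → R u v s → t v ≡ act s (t u)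
potential R Q i R⊆Q reach unique = do
  h ← fin-shift choose
  return ((λ u → act (proj₁ (h u)) true) , λ {u} {v} {s} a →
    let Qu , Qv = R⊆Q a
    in trans (cong (λ r → act r true) (unique Qv (proj₂ (h v) Qv) (proj₂ (h u) Qu ++ [ a ]ʷ)))
             (act-· (proj₁ (h u)) s true))
  where
  choose : ∀ u → ¬ ¬ ∃ λ s → Q u → Walk R i u s
  choose u = do
    inj₁ (s , W) ← em (∃ (Walk R i u))
      -- Unreached vertices lie outside `Q`; their sign `pos` is arbitrary.
      where inj₂ none → return (pos , λ Qu → ⊥-elim (reach Qu none))
    return (s , λ _ → W)

module _ (R : ArcRel n) (Q : Fin n → Set) (R⊆Q : ∀ {j i s} → R j i s → Q j × Q i)
         (connected : Connected R Q) where

  -- Two walks from `k` to the same vertex, prolonged by a common return walk, are closed and hence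
  -- positive, so their signs agree.
  balanced : ∀ {k} → Q k → ¬ NegClosed R →
    ¬ ¬ ∃ λ (t : Fin n → Bool) → ∀ {u v s} → R u v s → t v ≡ act s (t u)
  balanced {k} Qk none = potential R Q k R⊆Q (connected Qk) λ Qu W W′ → sign-stable do
    (r , V) ← connected Qu Qk
    return (·-cancelʳ _ _ r (trans (closed-pos none (W ++ V)) (sym (closed-pos none (W′ ++ V)))))

  -- Walks start at the head `i`: cutting at the last use of the arc keeps every vertex of `Q`
  -- reachable, and prolonging two walks to the tail `j` by a common walk avoiding the arc lets
  -- rigidity equate their signs.
  almost-balanced : ∀ {j i σ} → Rigid R j i σ →
    ¬ ¬ ∃ λ (t : Fin n → Bool) → ∀ {u v s} → R u v s → (u ≡ j × v ≡ i) ⊎ t v ≡ act s (t u)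
  almost-balanced {j} {i} {σ} (a , rigid) = do
    (t , bal) ← potential (R ∖ (j , i , σ)) Q i (λ r → R⊆Q (proj₁ r)) reach unique
    return (t , λ {u} {v} {s} b → extend t bal b ((u , v , s) ≟ᵃ (j , i , σ)))
    where
    reach : ∀ {u} → Q u → ¬ ¬ ∃ (Walk (R ∖ (j , i , σ)) i u)
    reach Qu = do
      (s , W) ← connected (proj₂ (R⊆Q a)) Qu
      return (walk-from-head j i σ W)

    unique : ∀ {u p q} → Q u → Walk (R ∖ (j , i , σ)) i u p → Walk (R ∖ (j , i , σ)) i u q → p ≡ q
    unique Qu W W′ = sign-stable do
      (s , V) ← connected Qu (proj₁ (R⊆Q a))
      let (r , V′) = walk-to-tail j i σ V
      return (·-cancelʳ _ _ r (rigid _ _ (W ++ V′) (W′ ++ V′)))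

    extend : ∀ t → (∀ {u v s} → (R ∖ (j , i , σ)) u v s → t v ≡ act s (t u)) →
      ∀ {u v s} → R u v s → Dec ((u , v , s) ≡ (j , i , σ)) → (u ≡ j × v ≡ i) ⊎ t v ≡ act s (t u)
    extend t bal b (yes refl) = inj₁ (refl , refl)
    extend t bal b (no ne) = inj₂ (bal (b , ne))

module _ {G : SignedDigraph n} (unique : AtMostOneNegCycle G) where

  -- A negative closed walk avoiding an arc of `C` would contain a negative cycle avoiding it, yet
  -- by uniqueness that cycle has the same arcs as `C`.
  critical-cycle : (∀ {j i s} → R j i s → Arc G j i s) → NegClosed R →
    ∃ λ j → ∃ λ i → ∃ λ σ → ∃ λ p → Critical R j i σ × Walk (Critical R) i j p
  critical-cycle {R = R} R⊆G W =
    let C , C-neg , C⊆R = neg-cycle R⊆G W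
        j , i , σ , p , a , D = cycle-walk C
        crit : ∀ {j i s} → ArcOf C j i s → Critical R j i s
        crit {j} {i} {s} b = C⊆R b , λ W′ →
          let D , D-neg , D⊆R = neg-cycle (λ r → R⊆G (proj₁ r)) W′
          in proj₂ (D⊆R (Equivalence.to (unique C D C-neg D-neg j i s) b)) refl
    in j , i , σ , p , crit a , walk-map crit D

  -- Both walks yield the same negative cycle, any arc of which will do. Hence negative closed walks
  -- cannot occur in two disjoint vertex sets.
  neg-closed-meet : (∀ {j i s} → R j i s → Arc G j i s) → (∀ {j i s} → R′ j i s → Arc G j i s) →
    NegClosed R → NegClosed R′ → ∃ λ j → ∃ λ i → ∃ λ s → R j i s × R′ j i s
  neg-closed-meet R⊆G R′⊆G W W′ =
    let C , C-neg , C⊆R = neg-cycle R⊆G W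
        D , D-neg , D⊆R′ = neg-cycle R′⊆G W′
        j , i , s , _ , a , _ = cycle-walk C
    in j , i , s , C⊆R a , D⊆R′ (Equivalence.to (unique C D C-neg D-neg j i s) a)

-- Asynchronous dynamics

flip-at : (x : Config n) (i : Fin n) → lookup (flip x i) i ≡ not (lookup x i)
flip-at x i = lookup∘updateAt i x

flip-off : (x : Config n) {i k : Fin n} → k ≢ i → lookup (flip x i) k ≡ lookup x k
flip-off x {i} {k} k≢i = lookup∘updateAt′ k i k≢i x

flip-flip : (x : Config n) (i : Fin n) → flip (flip x i) i ≡ x
flip-flip (a ∷ x) zero = cong (_∷ x) (not-involutive a)
flip-flip (a ∷ x) (suc i) = cong (a ∷_) (flip-flip x i)

interpolate : (P : Config n → Set) (x y : Config n) →
  (∀ z j → lookup z j ≡ lookup x j → lookup x j ≢ lookup y j → P z → P (flip z j)) → P x → P y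
interpolate P [] [] h px = px
interpolate P (a ∷ x) (b ∷ y) h px
  with interpolate (λ z → P (a ∷ z)) x y (λ z j → h (a ∷ z) (suc j)) px | a ≟ᵇ b
... | q | yes refl = q
... | q | no a≢b = subst (λ c → P (c ∷ y)) (sym (¬-not (≢-sym a≢b))) (h (a ∷ y) zero refl a≢b q)

influence : (f : BN n) (x : Config n) (j i : Fin n) {b : Bool} →
  lookup (f x) i ≡ b → lookup (f (flip x j)) i ≢ b → ∃ λ s → InfArc f j i s × act s (lookup x j) ≡ b
influence f x j i {b} e ne with lookup x j in ej
influence f x j i {false} e ne | false = pos , (x , ej , e , ¬-not ne) , refl
influence f x j i {true} e ne | false = neg , (x , ej , e , ¬-not ne) , refl
-- An `InfArc` witness has value `false` at `j`, so here it is `flip x j`, and the two values of `f`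
-- trade places.
influence f x j i {b} e ne | true = back b e ne
  where
  low : lookup (flip x j) j ≡ false
  low = trans (flip-at x j) (cong not ej)

  again : ∀ {c} → lookup (f x) i ≡ c → lookup (f (flip (flip x j) j)) i ≡ c
  again = trans (cong (λ z → lookup (f z) i) (flip-flip x j))

  back : ∀ b → lookup (f x) i ≡ b → lookup (f (flip x j)) i ≢ b →
    ∃ λ s → InfArc f j i s × act s true ≡ b
  back false e ne = neg , (flip x j , low , ¬-not ne , again e) , refl
  back true e ne = pos , (flip x j , low , ¬-not ne , again e) , refl

-- The points of `A` satisfying `P` form a nonempty trap set inside `A`, so by minimality they are
-- all of `A`. As `P` is closed only up to double negation, the set is built from its double
-- negation.
attractor-invariant : (f : BN n) {A : CSet n} → Attractor f A → (P : Config n → Set) →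
  (∀ x i → x ∈ₛ A → P x → lookup (f x) i ≢ lookup x i → ¬ ¬ P (flip x i)) →
  ∀ {x y} → x ∈ₛ A → P x → y ∈ₛ A → ¬ ¬ P y
attractor-invariant f {A} (_ , trap , least) P closed {x} {y} x∈A px y∈A = do
  (b , χ) ← config-decide (λ z → ¬ ¬ P z)
  let
    B = λ z → A z ∧ b z
    trap-B : TrapSet f B
    trap-B z i z∈B ne =
      let z∈A , bz = ∧-elim z∈B
      in ∧-intro (trap z i z∈A ne)
           (proj₂ (χ (flip z i)) (proj₁ (χ z) bz >>= λ pz → closed z i z∈A pz ne))
    x∈B = ∧-intro x∈A (proj₂ (χ x) (return px))
  proj₁ (χ y) (proj₂ (∧-elim {A y} (least B (x , x∈B) trap-B (λ z z∈B → proj₁ (∧-elim z∈B)) y y∈A)))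

attractors-equal : (f : BN n) {A B : CSet n} → Attractor f A → Attractor f B →
  ∀ {x} → x ∈ₛ A → x ∈ₛ B → A ≐ₛ B
attractors-equal f {A} {B} attA attB x∈A x∈B y with A y in eA | B y in eB
... | true  | true  = refl
... | false | false = refl
... | true  | false = contradiction (trans (sym eB) (bool-stable (attractor-invariant f attA (_∈ₛ B)
        (λ z i _ z∈B ne → return (proj₁ (proj₂ attB) z i z∈B ne)) x∈A x∈B eA))) λ ()
... | false | true  = contradiction (trans (sym eA) (bool-stable (attractor-invariant f attB (_∈ₛ A)
        (λ z i _ z∈A ne → return (proj₁ (proj₂ attA) z i z∈A ne)) x∈B x∈A eB))) λ ()

-- Agreement on vertex sets, hulls and layers

VSet : ℕ → Set
VSet n = Fin n → Bool

record Agree (X : VSet n) (x y : Config n) : Set where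
  constructor agreeing
  field on : ∀ {k} → X k ≡ true → lookup x k ≡ lookup y k

open Agree

agree-refl : {X : VSet n} {x : Config n} → Agree X x x
agree-refl = agreeing λ _ → refl

agree-sym : {X : VSet n} {x y : Config n} → Agree X x y → Agree X y x
agree-sym h = agreeing λ Xk → sym (on h Xk)

agree-trans : {X : VSet n} {x y z : Config n} → Agree X x y → Agree X y z → Agree X x z
agree-trans h h′ = agreeing λ Xk → trans (on h Xk) (on h′ Xk)

separate : (X : VSet n) {k i : Fin n} → X k ≡ true → X i ≡ false → k ≢ i
separate X Xk Xi refl = contradiction (trans (sym Xk) Xi) λ ()

agree-flip : (X : VSet n) (x : Config n) {i : Fin n} → X i ≡ false → Agree X x (flip x i)
agree-flip X x Xi = agreeing λ Xk → sym (flip-off x (separate X Xk Xi))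

agree-flip₂ : {X : VSet n} {x y : Config n} {i : Fin n} → X i ≡ true →
  Agree X x y → Agree X (flip x i) (flip y i)
agree-flip₂ {X = X} {x} {y} {i} Xi h = agreeing λ {k} Xk → at Xk (k ≟ i)
  where
  at : ∀ {k} → X k ≡ true → Dec (k ≡ i) → lookup (flip x i) k ≡ lookup (flip y i) k
  at Xk (yes refl) = trans (flip-at x i) (trans (cong not (on h Xk)) (sym (flip-at y i)))
  at Xk (no k≢i) = trans (flip-off x k≢i) (trans (on h Xk) (sym (flip-off y k≢i)))

Meet : VSet n → CSet n → CSet n → Set
Meet X A B = ∃ λ x → ∃ λ y → x ∈ₛ A × y ∈ₛ B × Agree X x y

Constant : VSet n → CSet n → Set
Constant X A = ∀ x y → x ∈ₛ A → y ∈ₛ A → Agree X x y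

-- Membership in the smallest subspace containing `A`, read off coordinate by coordinate.
record Hull (A : CSet n) (x : Config n) : Set where
  constructor hull
  field inherits : ∀ k b → (∀ {a} → a ∈ₛ A → lookup a k ≡ b) → lookup x k ≡ b

open Hull

≢⇒≡ : {a b c : Bool} → a ≢ c → b ≢ c → a ≡ b
≢⇒≡ a≢c b≢c = trans (¬-not a≢c) (sym (¬-not b≢c))

Closed : SignedDigraph n → VSet n → Set
Closed G X = ∀ {j i s} → Arc G j i s → X i ≡ true → X j ≡ true

record IsLayer (G : SignedDigraph n) (U Q : VSet n) : Set where
  field
    disjoint : ∀ {k} → Q k ≡ true → U k ≡ false
    closed-U : Closed G U
    closed-Q : ∀ {j i s} → Arc G j i s → Q i ≡ true → U j ≡ true ⊎ Q j ≡ true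

Inside : SignedDigraph n → VSet n → ArcRel n
Inside G X j i s = Arc G j i s × X j ≡ true × X i ≡ true

module Dynamics (f : BN n) (G : SignedDigraph n)
         (arc : ∀ {j i s} → InfArc f j i s → Arc G j i s) where

  -- On the way from `x` to `y`, a flip destroying the value `b` would reveal an arc along which the
  -- old value of its tail favours `b`; the hypothesis forbids such arcs.
  preserve : ∀ {x y i b} →
    (∀ j s → lookup x j ≢ lookup y j → Arc G j i s → act s (lookup x j) ≢ b) →
    lookup (f x) i ≡ b → lookup (f y) i ≡ b
  preserve {x} {y} {i} {b} h = interpolate (λ z → lookup (f z) i ≡ b) x y λ z j zj ne e →
    bool-stable λ ne′ →
      let s , inf , eq = influence f z j i e ne′
      in h j s ne (arc inf) (trans (cong (act s) (sym zj)) eq)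

  module Layer {U Q : VSet n} (layer : IsLayer G U Q) where

    open IsLayer layer

    local-U : ∀ {x y i} → Agree U x y → U i ≡ true → lookup (f x) i ≡ lookup (f y) i
    local-U agree Ui = sym (preserve (λ j s ne a → contradiction (on agree (closed-U a Ui)) ne) refl)

    local-Q : ∀ {x y i} → Agree U x y → Agree Q x y → Q i ≡ true → lookup (f x) i ≡ lookup (f y) i
    local-Q {x} {y} {i} agU agQ Qi = sym (preserve differ refl)
      where
      differ : ∀ j s → lookup x j ≢ lookup y j → Arc G j i s → act s (lookup x j) ≢ lookup (f x) i
      differ j s ne a with closed-Q a Qi
      ... | inj₁ Uj = contradiction (on agU Uj) ne
      ... | inj₂ Qj = contradiction (on agQ Qj) ne

    -- Moves on the closed set `U` depend on `U` alone, so `A` can replay the moves of `B` there and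
    -- leave all other coordinates as in `x`.
    transport : ∀ {A B x y y′} → Attractor f A → Attractor f B → x ∈ₛ A → y ∈ₛ B → Agree U x y →
      y′ ∈ₛ B → ¬ ¬ ∃ λ z → z ∈ₛ A × Agree U z y′ × (∀ k → U k ≡ false → lookup z k ≡ lookup x k)
    transport {A} {B} {x} attA attB x∈A y∈B agree y′∈B =
      attractor-invariant f attB Reached closed y∈B (x , x∈A , agree , λ _ _ → refl) y′∈B
      where
      Reached : Config n → Set
      Reached y = ∃ λ z → z ∈ₛ A × Agree U z y × (∀ k → U k ≡ false → lookup z k ≡ lookup x k)

      closed : ∀ y i → y ∈ₛ B → Reached y → lookup (f y) i ≢ lookup y i → ¬ ¬ Reached (flip y i)
      closed y i _ (z , z∈A , ag , off) ne with U i in Ui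
      ... | false = return (z , z∈A , agree-trans ag (agree-flip U y Ui) , off)
      ... | true = return (flip z i , proj₁ (proj₂ attA) z i z∈A ne′ , agree-flip₂ Ui ag
              , λ k Uk → trans (flip-off z (≢-sym (separate U Ui Uk))) (off k Uk))
        where
        ne′ : lookup (f z) i ≢ lookup z i
        ne′ e = ne (trans (sym (local-U ag Ui)) (trans e (on ag Ui)))

    -- Two replays: `B` first reaches a point matching `a` on `U`; from `a`, `A` then follows `B` on
    -- `U` as far as `b`, without touching `Q`, where `a` and `b` agree.
    join : ∀ {A B a b} → Attractor f A → Attractor f B → Meet U A B →
      a ∈ₛ A → b ∈ₛ B → Agree Q a b → ¬ ¬ ∃ λ x → ∃ λ y → x ∈ₛ A × y ∈ₛ B × Agree U x y × Agree Q x y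
    join {A} {B} {a} {b} attA attB (x₀ , y₀ , x₀∈A , y₀∈B , agree) a∈A b∈B agQ = do
      (y , y∈B , y≈a , _) ← transport attB attA y₀∈B x₀∈A (agree-sym agree) a∈A
      (z , z∈A , z≈b , off) ← transport attA attB a∈A y∈B (agree-sym y≈a) b∈B
      return (z , b , z∈A , b∈B , z≈b , agreeing λ Qk → trans (off _ (disjoint Qk)) (on agQ Qk))

    -- t k is the value of coordinate k that is regarded as the larger one.
    record Below (t : VSet n) (x y : Config n) : Set where
      constructor below
      field rise : ∀ {k} → Q k ≡ true → lookup x k ≡ t k → lookup y k ≡ t k

    open Below

    below-refl : ∀ {t x} → Below t x x
    below-refl = below λ _ e → e

    below-trans : ∀ {t x y z} → Below t x y → Below t y z → Below t x z
    below-trans h h′ = below λ Qk e → rise h′ Qk (rise h Qk e)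

    below-dual : ∀ {t x y} → Below (not ∘ t) x y → Below t y x
    below-dual h = below λ Qk e → bool-stable λ ne → not-¬ e (rise h Qk (¬-not ne))

    below-antisym : ∀ {t x y} → Below t x y → Below t y x → Agree Q x y
    below-antisym {t} {x} {y} h h′ = agreeing λ {k} Qk → at Qk (lookup x k ≟ᵇ t k)
      where
      at : ∀ {k} → Q k ≡ true → Dec (lookup x k ≡ t k) → lookup x k ≡ lookup y k
      at Qk (yes e) = trans e (sym (rise h Qk e))
      at Qk (no ne) = ≢⇒≡ ne (λ e → ne (rise h′ Qk e))

    miss : (t : VSet n) → Config n → VSet n
    miss t x k = Q k ∧ (lookup x k xor t k)

    miss-agree : ∀ {t x y} → Agree Q x y → ∀ k → miss t x k ≡ true → miss t y k ≡ true
    miss-agree {t} agree k e =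
      let Qk , m = ∧-elim {Q k} e
      in ∧-intro Qk (trans (cong (_xor t k) (sym (on agree Qk))) m)

    climb : ∀ t x {q} → Q q ≡ true → lookup x q ≢ t q →
      count (miss t (flip x q)) < count (miss t x)
    climb t x {q} Qq ne = count-strict _ _ sub q
      (¬-not λ e → xor-true (proj₂ (∧-elim {Q q} e)) flipped) (∧-intro Qq (xor-≢ ne))
      where
      flipped : lookup (flip x q) q ≡ t q
      flipped = trans (flip-at x q) (sym (¬-not (≢-sym ne)))

      sub : ∀ k → miss t (flip x q) k ≡ true → miss t x k ≡ true
      sub k e with ∧-elim {Q k} e | k ≟ q
      ... | _ | yes refl = ∧-intro Qq (xor-≢ ne)
      ... | Qk , m | no k≢q =
            ∧-intro Qk (trans (cong (_xor t k) (sym (flip-off x k≢q))) m)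

    Monotone : (t : VSet n) → Set
    Monotone t = ∀ {w x q} → Q q ≡ true → Agree U w x → Below t w x →
      lookup (f w) q ≡ t q → lookup (f x) q ≡ t q

    MonotoneExcept : (t : VSet n) → Fin n → Fin n → Set
    MonotoneExcept t j i = ∀ {w x q} → Q q ≡ true → Agree U w x → Below t w x →
      (q ≡ i → lookup w j ≡ lookup x j) → lookup (f w) q ≡ t q → lookup (f x) q ≡ t q

    -- If `w` is below `x`, a changed coordinate `j` in `Q` has its small value in `w`; an arc
    -- compatible with the switching `t` turns this into the small value at `q`, so `preserve`
    -- applies to the value `t q`.
    monotone-at : ∀ {t w x q} → Q q ≡ true → Agree U w x → Below t w x →
      (∀ {j s} → Inside G Q j q s → lookup w j ≢ lookup x j → t q ≡ act s (t j)) →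
      lookup (f w) q ≡ t q → lookup (f x) q ≡ t q
    monotone-at {t} {w} {x} {q} Qq w≈x w≤x balanced = preserve differ
      where
      differ : ∀ j s → lookup w j ≢ lookup x j → Arc G j q s → act s (lookup w j) ≢ t q
      differ j s ne a e with closed-Q a Qq
      ... | inj₁ Uj = ne (on w≈x Uj)
      ... | inj₂ Qj = not-¬ (balanced (a , Qj , Qq) ne) (trans (sym e)
              (trans (cong (act s) (¬-not λ e′ → ne (trans e′ (sym (rise w≤x Qj e′)))))
                (act-not s (t j))))

    monotone-dual : ∀ {t} → Monotone t → Monotone (not ∘ t)
    monotone-dual mono Qq ag w≤x e = ¬-not λ e′ →
      not-¬ (mono Qq (agree-sym ag) (below-dual w≤x) e′) e

    monotone-except-dual : ∀ {t j i} → MonotoneExcept t j i → MonotoneExcept (not ∘ t) j i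
    monotone-except-dual mono Qq ag w≤x fix e = ¬-not λ e′ →
      not-¬ (mono Qq (agree-sym ag) (below-dual w≤x) (sym ∘ fix) e′) e

    -- Moves of A cannot leave the configurations lying below M on Q, even after replacing
    -- f on Q by its monotone upper envelope.
    record TopStable (t : VSet n) (A : CSet n) (M : Config n) : Set where
      constructor topStable
      field caps : ∀ {w y q} → y ∈ₛ A → Agree U w y → Below t w M →
              Q q ≡ true → lookup (f w) q ≡ t q → lookup M q ≡ t q

    open TopStable

    -- For each point `z` of `A`, `B` has one with the same values on `U`; thus `z` may serve as the
    -- `w` of `caps`, and no move of `A` in `Q` escapes from below `M`.
    stays-below : ∀ {t A B M a z} → Attractor f A → Attractor f B → Meet U A B →
      TopStable t B M → a ∈ₛ A → Below t a M → z ∈ₛ A → Below t z M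
    stays-below {t} {A} {B} {M} attA attB (x₀ , y₀ , x₀∈A , y₀∈B , agree) stable a∈A a≤M z∈A =
      below λ Qk e → bool-stable do
        z≤M ← attractor-invariant f attA (λ z → Below t z M) closed a∈A a≤M z∈A
        return (rise z≤M Qk e)
      where
      closed : ∀ z i → z ∈ₛ A → Below t z M → lookup (f z) i ≢ lookup z i → ¬ ¬ Below t (flip z i) M
      closed z i z∈A z≤M ne = do
        (y , y∈B , y≈z , _) ← transport attB attA y₀∈B x₀∈A (agree-sym agree) z∈A
        return (below λ {k} Qk e → grow y∈B y≈z k Qk e (k ≟ i))
        where
        grow : ∀ {y} → y ∈ₛ B → Agree U y z → ∀ k → Q k ≡ true → lookup (flip z i) k ≡ t k →
          Dec (k ≡ i) → lookup M k ≡ t k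
        grow y∈B y≈z k Qk e (no k≢i) = rise z≤M Qk (trans (sym (flip-off z k≢i)) e)
        grow y∈B y≈z k Qk e (yes refl) = caps stable y∈B (agree-sym y≈z) z≤M Qk
          (trans (¬-not ne) (trans (sym (flip-at z k)) e))

    top-is-max : ∀ {t A M z} → Attractor f A → M ∈ₛ A → TopStable t A M → z ∈ₛ A → Below t z M
    top-is-max attA M∈A stable = stays-below attA attA (_ , _ , M∈A , M∈A , agree-refl)
      stable M∈A below-refl

    bottom-is-min : ∀ {t A m z} → Attractor f A → m ∈ₛ A → TopStable (not ∘ t) A m →
      z ∈ₛ A → Below t m z
    bottom-is-min attA m∈A stable z∈A = below-dual (top-is-max attA m∈A stable z∈A)

    -- Where `m` has the large value, so have all of `A` and hence `x`; were `M` small there, `B`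
    -- would force the small value on `x`.
    hulls-cross : ∀ {t A B m M x} → (∀ {z} → z ∈ₛ A → Below t m z) → (∀ {z} → z ∈ₛ B → Below t z M) →
      Hull A x → Hull B x → Below t m M
    hulls-cross {t} least greatest hullA hullB = below λ {k} Qk e → bool-stable λ ne → not-¬
      (inherits hullA k (t k) (λ a∈A → rise (least a∈A) Qk e))
      (inherits hullB k (not (t k)) (λ b∈B → ¬-not λ e′ → ne (rise (greatest b∈B) Qk e′)))

    -- `hulls-cross` puts the least point of each attractor below the top of the other, and
    -- `stays-below` carries the whole attractor along, so each top is below the other.
    tops-agree : ∀ {t A B M M′ m m′ x} → Attractor f A → Attractor f B → Meet U A B →
      Hull A x → Hull B x → M ∈ₛ A → TopStable t A M → M′ ∈ₛ B → TopStable t B M′ →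
      m ∈ₛ A → (∀ {z} → z ∈ₛ A → Below t m z) → m′ ∈ₛ B → (∀ {z} → z ∈ₛ B → Below t m′ z) →
      Agree Q M M′
    tops-agree {t} attA attB meet@(x₀ , y₀ , x₀∈A , y₀∈B , agree) hullA hullB
               M∈A top M′∈B top′ m∈A least m′∈B least′ =
      below-antisym {t}
        (stays-below attA attB meet top′ m∈A
          (hulls-cross least (top-is-max attB M′∈B top′) hullA hullB) M∈A)
        (stays-below attB attA (y₀ , x₀ , y₀∈B , x₀∈A , agree-sym agree) top m′∈B
          (hulls-cross least′ (top-is-max attA M∈A top) hullB hullA) M′∈B)

    monotone-top : ∀ {t A} → Monotone t → Attractor f A → ¬ ¬ ∃ λ M → M ∈ₛ A × TopStable t A M
    monotone-top {t} {A} mono attA@(inhabited , trap , _) = do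
      (M , M∈A , maximal) ← minimal (count ∘ miss t) (_∈ₛ A) inhabited
      return (M , M∈A , topStable λ {w} {y} {q} y∈A w≈y w≤M Qq e → bool-stable do
        -- Replaying on `U` from `M` gives a point of `A` with the `U`-values of `y` and the
        -- `Q`-values of `M`; an upward move there would contradict the maximality of `M`.
        (z , z∈A , z≈y , off) ← transport attA attA M∈A M∈A agree-refl y∈A
        let
          same : Agree Q z M
          same = agreeing λ Qk → off _ (disjoint Qk)
          fz = mono {w} {z} Qq (agree-trans w≈y (agree-sym z≈y))
                 (below λ Qk e → trans (on same Qk) (rise w≤M Qk e)) e
        λ Mq≢ →
          let zq≢ = λ e′ → Mq≢ (trans (sym (on same Qq)) e′)
          in maximal (flip z q) (trap z q z∈A λ e′ → zq≢ (trans (sym e′) fz))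
               (<-≤-trans (climb t z Qq zq≢) (count-mono _ _ (miss-agree same))))

    Fixed : Config n → Set
    Fixed x = ∀ q → Q q ≡ true → lookup (f x) q ≡ lookup x q

    fixed-constant : ∀ {A M z} → Attractor f A → Constant U A → M ∈ₛ A → Fixed M → z ∈ₛ A → Agree Q z M
    fixed-constant {A} {M} attA constant M∈A fixed z∈A = agreeing λ Qk → bool-stable do
      agree ← attractor-invariant f attA (λ z → Agree Q z M) closed M∈A agree-refl z∈A
      return (on agree Qk)
      where
      closed : ∀ z i → z ∈ₛ A → Agree Q z M → lookup (f z) i ≢ lookup z i → ¬ ¬ Agree Q (flip z i) M
      closed z i z∈A z≈M ne with Q i in Qi
      ... | false = return (agree-trans (agree-sym (agree-flip Q z Qi)) z≈M)
      ... | true = contradiction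
              (trans (local-Q (constant _ _ z∈A M∈A) z≈M Qi) (trans (fixed i Qi) (sym (on z≈M Qi)))) ne

    -- x lies below its image under the monotone upper envelope of f on Q.
    Supported : (t : VSet n) → Config n → Set
    Supported t x = ∀ q → Q q ≡ true → lookup x q ≡ t q →
      ∃ λ w → Agree U w x × Below t w x × lookup (f w) q ≡ t q

    Full : (t : VSet n) → Config n → Set
    Full t x = ∀ q → Q q ≡ true → lookup (f x) q ≡ t q → lookup x q ≡ t q

    -- Support holds at a lowest point of `A` and survives upward moves, so a highest supported
    -- point admits no upward move on `Q`.
    supported-max : ∀ {t A} → Attractor f A →
      ¬ ¬ ∃ λ r → r ∈ₛ A × Supported t r × Full t r
    supported-max {t} {A} (inhabited , trap , _) = do
      (m , m∈A , m-min) ← minimal (count ∘ miss (not ∘ t)) (_∈ₛ A) inhabited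
      let
        m-supported : Supported t m
        -- A large value of `m` not confirmed by `f m` could be lowered, against the choice of `m`.
        m-supported q Qq e = m , agree-refl , below-refl , bool-stable λ ne →
          m-min (flip m q) (trap m q m∈A λ e′ → ne (trans e′ e)) (climb (not ∘ t) m Qq (not-¬ e))
      (r , (r∈A , supp) , r-max) ← minimal (count ∘ miss t) (λ x → x ∈ₛ A × Supported t x)
        (m , m∈A , m-supported)
      return (r , r∈A , supp , λ q Qq e → bool-stable λ ne →
        r-max (flip r q) (trap r q r∈A (λ e′ → ne (trans (sym e′) e)) , raise supp Qq ne e)
          (climb t r Qq ne))
      where
      raise : ∀ {r q} → Supported t r → Q q ≡ true → lookup r q ≢ t q → lookup (f r) q ≡ t q →
        Supported t (flip r q)
      raise {r} {q} supp Qq ne e k Qk ek = from (k ≟ q)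
        where
        up : Below t r (flip r q)
        up = below λ Ql el → trans (flip-off r λ { refl → ne el }) el

        from : Dec (k ≡ q) → ∃ λ w → Agree U w (flip r q) × Below t w (flip r q) × lookup (f w) k ≡ t k
        from (yes refl) = r , agree-flip U r (disjoint Qq) , up , e
        from (no k≢q) =
          let w , w≈r , w≤r , ew = supp k Qk (trans (sym (flip-off r k≢q)) ek)
          in w , agree-trans w≈r (agree-flip U r (disjoint Qq))
               , below-trans w≤r up , ew

    -- For monotone `f` the envelope is `f` itself: on `Q`, support puts `r` below `f r` and
    -- fullness puts `f r` below `r`.
    monotone-fixed : ∀ {t A} → Monotone t → Attractor f A → ¬ ¬ ∃ λ r → r ∈ₛ A × Fixed r
    monotone-fixed {t} mono attA = do
      (r , r∈A , supp , full) ← supported-max {t} attA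
      return (r , r∈A , λ q Qq → case r supp full Qq (lookup r q ≟ᵇ t q))
      where
      case : ∀ r → Supported t r → Full t r →
        ∀ {q} → Q q ≡ true → Dec (lookup r q ≡ t q) → lookup (f r) q ≡ lookup r q
      case r supp full Qq (yes e) =
        let w , w≈r , w≤r , ew = supp _ Qq e
        in trans (mono Qq w≈r w≤r ew) (sym e)
      case r supp full Qq (no ne) = ≢⇒≡ (λ e → ne (full _ Qq e)) ne

    -- If r is not top-stable, the only obstruction sits at i; there r and f r both have the
    -- small value, while f r agrees with its envelope elsewhere: hence r is fixed.
    almost-monotone-top : ∀ {t j i A} → MonotoneExcept t j i → Attractor f A → Constant U A →
      ¬ ¬ ((∃ λ r → r ∈ₛ A × Fixed r) ⊎ (∃ λ M → M ∈ₛ A × TopStable t A M))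
    almost-monotone-top {t} {j} {i} {A} mono attA constant = do
      (r , r∈A , supp , full) ← supported-max {t} attA
      inj₁ (w , q , w≈r , w≤r , Qq , e , ne) ← em (∃ λ w → ∃ λ q →
          Agree U w r × Below t w r × Q q ≡ true × lookup (f w) q ≡ t q × lookup r q ≢ t q)
        where inj₂ none → return (inj₂ (r , r∈A , topStable λ {w} {y} {q} y∈A w≈y w≤r Qq e →
                bool-stable λ ne → none (w , q , agree-trans w≈y (constant _ _ y∈A r∈A) , w≤r , Qq , e , ne)))
      let
        q≡i : q ≡ i
        q≡i = decidable-stable (q ≟ i) λ q≢i →
          ne (full q Qq (mono Qq w≈r w≤r (λ q≡i → contradiction q≡i q≢i) e))
        fixed : ∀ {k} → Q k ≡ true → Dec (lookup r k ≡ t k) → lookup (f r) k ≡ lookup r k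
        fixed {k} Qk = λ where
          (yes e′) →
            let w , w≈r , w≤r , ew = supp k Qk e′
            in trans (mono Qk w≈r w≤r (λ k≡i → contradiction
                 (subst (λ l → lookup r l ≡ t l) (trans k≡i (sym q≡i)) e′) ne) ew) (sym e′)
          (no ne′) → ≢⇒≡ (λ e′ → ne′ (full k Qk e′)) ne′
      return (inj₁ (r , r∈A , λ k Qk → fixed Qk (lookup r k ≟ᵇ t k)))

    -- Extreme configurations of attractors with a common hull point

    Extremes : (t : VSet n) → CSet n → Set
    Extremes t A = (∃ λ M → M ∈ₛ A × TopStable t A M) × (∃ λ m → m ∈ₛ A × TopStable (not ∘ t) A m)

    monotone-extremes : ∀ {t A} → Monotone t → Attractor f A → ¬ ¬ Extremes t A
    monotone-extremes mono attA = do
      top ← monotone-top mono attA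
      bottom ← monotone-top (monotone-dual mono) attA
      return (top , bottom)

    almost-monotone-extremes : ∀ {t j i A} → MonotoneExcept t j i → Attractor f A → Constant U A →
      ¬ ¬ ((∃ λ r → r ∈ₛ A × Fixed r) ⊎ Extremes t A)
    almost-monotone-extremes mono attA constant = do
      inj₂ top ← almost-monotone-top mono attA constant
        where inj₁ fixed → return (inj₁ fixed)
      inj₂ bottom ← almost-monotone-top (monotone-except-dual mono) attA constant
        where inj₁ fixed → return (inj₁ fixed)
      return (inj₂ (top , bottom))

    module _ {A B : CSet n} (attA : Attractor f A) (attB : Attractor f B) (meet : Meet U A B)
             {x : Config n} (hullA : Hull A x) (hullB : Hull B x) where

      MeetOnQ : Set
      MeetOnQ = ∃ λ a → ∃ λ b → a ∈ₛ A × b ∈ₛ B × Agree Q a b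

      extremes-meet : ∀ {t} → Extremes t A → Extremes t B → MeetOnQ
      extremes-meet {t} ((M , M∈A , top) , (m , m∈A , bot)) ((M′ , M′∈B , top′) , (m′ , m′∈B , bot′)) =
        M , M′ , M∈A , M′∈B , tops-agree {t} attA attB meet hullA hullB M∈A top M′∈B top′
          m∈A (bottom-is-min attA m∈A bot) m′∈B (bottom-is-min attB m′∈B bot′)

      fixed-extreme-meet : ∀ {t a} → Constant U A → a ∈ₛ A → Fixed a → TopStable t A a →
        Extremes t B → MeetOnQ
      fixed-extreme-meet {t} {a} constant a∈A fixed top ((M′ , M′∈B , top′) , (m′ , m′∈B , bot′)) =
        a , M′ , a∈A , M′∈B , tops-agree {t} attA attB meet hullA hullB a∈A top M′∈B top′
          a∈A (λ z∈A → below λ Qk e → trans (on (fixed-constant attA constant a∈A fixed z∈A) Qk) e)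
          m′∈B (bottom-is-min attB m′∈B bot′)

      fixed-fixed-meet : ∀ {a b} → Constant U A → Constant U B →
        a ∈ₛ A → Fixed a → b ∈ₛ B → Fixed b → MeetOnQ
      fixed-fixed-meet {a} {b} constA constB a∈A fixA b∈B fixB = a , b , a∈A , b∈B , agreeing λ {k} Qk →
        trans (sym (inherits hullA k _ λ z∈A → on (fixed-constant attA constA a∈A fixA z∈A) Qk))
              (inherits hullB k _ λ z∈B → on (fixed-constant attB constB b∈B fixB z∈B) Qk)

    -- If `a` is small at `j`, so is every `w` below it, and the exception at `i` is harmless: on
    -- `Q`, `f w` is below `f a`, which equals `a`.
    fixed-top : ∀ {t j i A a} → MonotoneExcept t j i → Q j ≡ true → Constant U A → a ∈ₛ A → Fixed a →
      lookup a j ≢ t j → TopStable t A a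
    fixed-top {t} {j} mono Qj constant a∈A fixed ne = topStable λ y∈A w≈y w≤a Qq e →
      trans (sym (fixed _ Qq)) (mono Qq (agree-trans w≈y (constant _ _ y∈A a∈A)) w≤a
        (λ _ → ≢⇒≡ (λ e′ → ne (rise w≤a Qj e′)) ne) e)

    extremes-dual : ∀ {t A} → Extremes t A → Extremes (not ∘ t) A
    extremes-dual {t} {A} ((M , M∈A , top) , bottom) = bottom , M , M∈A ,
      topStable λ y∈A w≈y w≤M Qq e → trans (caps top y∈A w≈y (below λ Qk e′ → trans
        (rise w≤M Qk (trans e′ (sym (not-involutive _)))) (not-involutive _)) Qq
        (trans e (not-involutive _))) (sym (not-involutive _))

    -- The value of `a` at `j` is the small one either for `t` or for the dual order, so `fixed-top`
    -- applies in one of the two.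
    fixed-meet : ∀ {t j i A B a x} → MonotoneExcept t j i → Q j ≡ true →
      Attractor f A → Attractor f B → Meet U A B → Hull A x → Hull B x →
      Constant U A → a ∈ₛ A → Fixed a → Extremes t B →
      ∃ λ a → ∃ λ b → a ∈ₛ A × b ∈ₛ B × Agree Q a b
    fixed-meet {t} {j} {a = a} mono Qj attA attB meet hullA hullB constant a∈A fixed ext
      with lookup a j ≟ᵇ t j
    ... | no ne = fixed-extreme-meet attA attB meet hullA hullB constant a∈A fixed
            (fixed-top mono Qj constant a∈A fixed ne) ext
    ... | yes e = fixed-extreme-meet attA attB meet hullA hullB constant a∈A fixed
            (fixed-top (monotone-except-dual mono) Qj constant a∈A fixed (not-¬ e)) (extremes-dual ext)

    almost-monotone-meet : ∀ {t j i A B x} → MonotoneExcept t j i → Q j ≡ true →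
      Attractor f A → Attractor f B → Meet U A B → Hull A x → Hull B x →
      Constant U A → Constant U B → ¬ ¬ ∃ λ a → ∃ λ b → a ∈ₛ A × b ∈ₛ B × Agree Q a b
    almost-monotone-meet mono Qj attA attB meet@(x , y , x∈A , y∈B , agree) hullA hullB constA constB = do
      shapeA ← almost-monotone-extremes mono attA constA
      shapeB ← almost-monotone-extremes mono attB constB
      return (combine shapeA shapeB)
      where
      combine : _ → _ → _
      combine (inj₁ (a , a∈A , fixA)) (inj₁ (b , b∈B , fixB)) =
        fixed-fixed-meet attA attB meet hullA hullB constA constB a∈A fixA b∈B fixB
      combine (inj₁ (a , a∈A , fixA)) (inj₂ extB) =
        fixed-meet mono Qj attA attB meet hullA hullB constA a∈A fixA extB
      combine (inj₂ extA) (inj₁ (b , b∈B , fixB)) =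
        let b , a , b∈B , a∈A , ag = fixed-meet mono Qj attB attA
              (y , x , y∈B , x∈A , agree-sym agree) hullB hullA constB b∈B fixB extA
        in a , b , a∈A , b∈B , agree-sym ag
      combine (inj₂ extA) (inj₂ extB) = extremes-meet attA attB meet hullA hullB extA extB

-- Strongly connected layers

module _ (G : SignedDigraph n) where

  record IsComponent (U Q : VSet n) : Set where
    field
      layer     : IsLayer G U Q
      root      : Fin n
      root∈Q    : Q root ≡ true
      connected : Connected (Inside G Q) (λ k → Q k ≡ true)

  Above : VSet n → VSet n → Set
  Above U X = Closed G X × (∀ k → U k ≡ true → X k ≡ true) × ∃ λ k → X k ≡ true × U k ≡ false

  -- A minimal closed set X strictly above U adds a single strong component: for v in X ∖ U,
  -- U together with the ancestors of v in X ∖ U is closed, hence equals X.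
  module _ {U X : VSet n} (closed-U : Closed G U) (closed-X : Closed G X)
           (U⊆X : ∀ k → U k ≡ true → X k ≡ true) {r : Fin n} (Xr : X r ≡ true) (Ur : U r ≡ false)
           (least : ∀ Y → Above U Y → ¬ (count Y < count X)) where

    private
      Q : VSet n
      Q k = X k ∧ not (U k)

      Ancestor : Fin n → Fin n → Set
      Ancestor v w = Q w ≡ true × ∃ (Walk (Inside G Q) w v)

      outside : ∀ {k} → Q k ≡ true → U k ≡ false
      outside {k} Qk = trans (sym (not-involutive (U k))) (cong not (proj₂ (∧-elim {X k} Qk)))

      split : ∀ {j} → X j ≡ true → U j ≡ true ⊎ Q j ≡ true
      split {j} Xj with U j
      ... | true = inj₁ refl
      ... | false = inj₂ (∧-intro Xj refl)

      ancestors-closed : ∀ {v j i s} → Arc G j i s →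
        U i ≡ true ⊎ Ancestor v i → U j ≡ true ⊎ Ancestor v j
      ancestors-closed a (inj₁ Ui) = inj₁ (closed-U a Ui)
      ancestors-closed a (inj₂ (Qi , s , W)) =
        map₂ (λ Qj → Qj , _ , cons (a , Qj , Qi) W) (split (closed-X a (proj₁ (∧-elim Qi))))

      connected : Connected (Inside G Q) (λ k → Q k ≡ true)
      connected {u} {v} Qu Qv = do
        (Y , χ) ← fin-decide (λ w → U w ≡ true ⊎ Ancestor v w)
        let
          Y⊆X : ∀ k → Y k ≡ true → X k ≡ true
          Y⊆X k Yk = [ U⊆X k , (λ anc → proj₁ (∧-elim (proj₁ anc))) ]′ (proj₁ (χ k) Yk)
          Y-above : Above U Y
          Y-above = (λ {j} {i} a Yi → proj₂ (χ j) (ancestors-closed a (proj₁ (χ i) Yi)))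
                  , (λ k Uk → proj₂ (χ k) (inj₁ Uk))
                  , v , proj₂ (χ v) (inj₂ (Qv , pos , nil)) , outside Qv
          Yu : Y u ≡ true
          Yu = bool-stable λ ne →
            least Y Y-above (count-strict Y X Y⊆X u (¬-not ne) (proj₁ (∧-elim Qu)))
        return ([ (λ Uu → contradiction (trans (sym Uu) (outside Qu)) λ ()) , proj₂ ]′ (proj₁ (χ u) Yu))

    minimal-above : IsComponent U Q
    minimal-above = record
      { layer = record
        { disjoint = outside
        ; closed-U = closed-U
        ; closed-Q = λ a Qi → split (closed-X a (proj₁ (∧-elim Qi)))
        }
      ; root = r
      ; root∈Q = ∧-intro Xr (cong not Ur)
      ; connected = connected
      }

  component : ∀ {U k} → Closed G U → U k ≡ false → ¬ ¬ ∃ (IsComponent U)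
  component {U} {k} closed-U Uk = do
    (X , (closed-X , U⊆X , r , Xr , Ur) , least) ← minimal count (Above U)
      ((λ _ → true) , (λ _ _ → refl) , (λ _ _ → refl) , k , refl , Uk)
    return (_ , minimal-above closed-U closed-X U⊆X Xr Ur least)

  _∪_ : VSet n → VSet n → VSet n
  (U ∪ Q) k = U k ∨ Q k

  ∪-closed : ∀ {U Q} → IsLayer G U Q → Closed G (U ∪ Q)
  ∪-closed {U} {Q} layer {j} a e with ∨-elim {U _} e
  ... | inj₁ Ui = ∨-introˡ (IsLayer.closed-U layer a Ui)
  ... | inj₂ Qi = [ ∨-introˡ , ∨-introʳ {U j} ]′ (IsLayer.closed-Q layer a Qi)

  -- Take a largest closed `U` with `P U`; a vertex left out would give a further component `Q`, and
  -- `U ∪ Q` would be larger.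
  component-induction : (P : VSet n → Set) → P (λ _ → false) →
    (∀ {U Q} → IsComponent U Q → P U → ¬ ¬ P (U ∪ Q)) → ¬ ¬ ∃ λ U → (∀ k → U k ≡ true) × P U
  component-induction P base extend = do
    (U , (closed-U , PU) , maximal) ← minimal (λ U → count (not ∘ U)) (λ U → Closed G U × P U)
      ((λ _ → false) , (λ _ ()) , base)
    inj₁ (k , Uk) ← em (∃ λ k → U k ≡ false)
      where inj₂ all → return (U , (λ k → bool-stable λ ne → all (k , ¬-not ne)) , PU)
    (Q , comp) ← component closed-U Uk
    PUQ ← extend comp PU
    let
      open IsComponent comp
      Ur = IsLayer.disjoint layer root∈Q
    ⊥-elim (maximal (U ∪ Q) (∪-closed layer , PUQ)
      (count-strict _ _ (λ k e → shrink (U k) e) root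
        (cong not (∨-introʳ {U root} root∈Q)) (cong not Ur)))
    where
    shrink : ∀ a {b} → not (a ∨ b) ≡ true → not a ≡ true
    shrink true ()
    shrink false _ = refl

-- From components to the whole network

module _ {f : BN n} {G : SignedDigraph n} (arc : ∀ {j i s} → InfArc f j i s → Arc G j i s)
         (unique : AtMostOneNegCycle G) where

  open Dynamics f G arc
  open Layer

  component-monotone : ∀ {U Q} (comp : IsComponent G U Q) → let open IsComponent comp in
    ¬ ¬ ((¬ NegClosed (Inside G Q) × ∃ (Monotone layer)) ⊎
         (NegClosed (Inside G Q) × ∃ λ t → ∃ λ j → ∃ λ i → Q j ≡ true × MonotoneExcept layer t j i))
  component-monotone {U} {Q} comp = do
    inj₁ W ← em (NegClosed (Inside G Q))
      where inj₂ none → balanced (Inside G Q) (λ k → Q k ≡ true) proj₂ connected root∈Q none >>=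
              λ (t , bal) → return (inj₁ (none , t , λ {w} {x} {q} Qq w≈x w≤x →
                monotone-at layer Qq w≈x w≤x λ b _ → bal b))
    let (_ , _ , _ , _ , crit , D) = critical-cycle unique proj₁ W
    (j , i , σ , rigid) ← rigid-exists crit D
    (t , bal) ← almost-balanced (Inside G Q) (λ k → Q k ≡ true) proj₂ connected rigid
    return (inj₂ (W , t , j , i , proj₁ (proj₂ (proj₁ rigid)) , λ {w} {x} {q} Qq w≈x w≤x same →
      monotone-at layer Qq w≈x w≤x λ b ne →
        [ (λ { (refl , refl) → contradiction (same refl) ne }) , (λ e → e) ]′ (bal b)))
    where open IsComponent comp

  constant-∪ : ∀ {U Q t A} (layer : IsLayer G U Q) → Monotone layer t → Attractor f A →
    Constant U A → Constant (_∪_ G U Q) A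
  constant-∪ {U} {Q} {A = A} layer mono attA constant x y x∈A y∈A = agreeing λ {k} e → bool-stable do
    (r , r∈A , fixed) ← monotone-fixed layer mono attA
    let
      same : ∀ {z} → z ∈ₛ A → Agree Q z r
      same = fixed-constant layer attA constant r∈A fixed
    return ([ on (constant x y x∈A y∈A) , on (agree-trans (same x∈A) (agree-sym (same y∈A))) ]′
      (∨-elim {U k} e))

  module _ {A B : CSet n} (attA : Attractor f A) (attB : Attractor f B)
           {x : Config n} (hullA : Hull A x) (hullB : Hull B x) where

    private
      -- Constancy is needed only until the component of the negative cycle is added; afterwards its
      -- premise fails and only the meeting is carried on.
      Progress : VSet n → Set
      Progress U = (¬ NegClosed (Inside G U) → Constant U A × Constant U B) × Meet U A B

      extend : ∀ {U Q} → IsComponent G U Q → Progress U → ¬ ¬ Progress (_∪_ G U Q)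
      extend {U} {Q} comp (constant , meet) = component-monotone comp >>= λ where
          (inj₁ (_ , t , mono)) → do
            extA ← monotone-extremes layer mono attA
            extB ← monotone-extremes layer mono attB
            meet′ ← joined (extremes-meet layer attA attB meet hullA hullB extA extB)
            return ((λ none →
                let constA , constB = constant λ (u , W) → none (u , walk-map U⊆ W)
                in constant-∪ layer mono attA constA , constant-∪ layer mono attB constB)
              , meet′)
          (inj₂ (W@(u , V) , t , j , i , Qj , mono)) → do
            let
              -- `Q` has a negative closed walk, so `U`, being disjoint from it, has none.
              constA , constB = constant λ W′ →
                let _ , _ , _ , (_ , Qj , _) , (_ , Uj , _) = neg-closed-meet unique proj₁ proj₁ W W′
                in contradiction (trans (sym Uj) (IsLayer.disjoint layer Qj)) λ ()
            onQ ← almost-monotone-meet layer mono Qj attA attB meet hullA hullB constA constB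
            meet′ ← joined onQ
            return ((λ none → contradiction (u , walk-map Q⊆ V) none) , meet′)
        where
        open IsComponent comp

        U⊆ : ∀ {j i s} → Inside G U j i s → Inside G (_∪_ G U Q) j i s
        U⊆ (a , Uj , Ui) = a , ∨-introˡ Uj , ∨-introˡ Ui

        Q⊆ : ∀ {j i s} → Inside G Q j i s → Inside G (_∪_ G U Q) j i s
        Q⊆ {j} {i} (a , Qj , Qi) = a , ∨-introʳ {U j} Qj , ∨-introʳ {U i} Qi

        joined : (∃ λ a → ∃ λ b → a ∈ₛ A × b ∈ₛ B × Agree Q a b) → ¬ ¬ Meet (_∪_ G U Q) A B
        joined (a , b , a∈A , b∈B , agQ) = do
          (x , y , x∈A , y∈B , agU , agQ′) ← join layer attA attB meet a∈A b∈B agQ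
          return (x , y , x∈A , y∈B , agreeing λ {k} e → [ on agU , on agQ′ ]′ (∨-elim {U k} e))

    hulls-meet⇒equal : ¬ ¬ (A ≐ₛ B)
    hulls-meet⇒equal = do
      let (a , a∈A) = proj₁ attA
          (b , b∈B) = proj₁ attB
      (U , all , _ , x , y , x∈A , y∈B , agree) ← component-induction G Progress
        ((λ _ → (λ _ _ _ _ → agreeing λ ()) , (λ _ _ _ _ → agreeing λ ()))
          , a , b , a∈A , b∈B , agreeing λ ())
        extend
      return (attractors-equal f attA attB
        (interpolate (_∈ₛ A) x y (λ _ j _ ne _ → contradiction (on agree (all j)) ne) x∈A) y∈B)

  module _ (strong : StronglyConnected G) {A : CSet n} (attA : Attractor f A) where

    private
      whole : Fin n → IsComponent G (λ _ → false) (λ _ → true)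
      whole k = record
        { layer = record { disjoint = λ _ → refl ; closed-U = λ _ () ; closed-Q = λ _ _ → inj₂ refl }
        ; root = k
        ; root∈Q = refl
        ; connected = λ {u} {v} _ _ → return (walk (strong u v))
        }
        where
        walk : ∀ {u v} → Reach G u v → ∃ (Walk (Inside G (λ _ → true)) u v)
        walk here = pos , nil
        walk (step s r a) = _ , proj₂ (walk r) ++ [ a , refl , refl ]ʷ

    -- This makes the span of `A` a trap space. If `A` has extremes, `x` lies between them, and
    -- stability forces `f x` at `i` to the value of one of them, which is `b`; otherwise `A` is a
    -- single fixed point and `x` equals it.
    hull-closed : ∀ {x i b} → Hull A x → (∀ {a} → a ∈ₛ A → lookup a i ≡ b) → lookup (f x) i ≡ b
    hull-closed {x} {i} {b} hullA value = bool-stable (component-monotone (whole i) >>= λ where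
        (inj₁ (_ , t , mono)) → do
          ext ← monotone-extremes L mono attA
          return (by-extremes ext)
        (inj₂ (_ , t , _ , _ , _ , mono)) → do
          inj₂ ext ← almost-monotone-extremes L mono attA constant
            where inj₁ (r , r∈A , fixed) → return (by-fixed r∈A fixed)
          return (by-extremes ext))
      where
      L = IsComponent.layer (whole i)

      constant : Constant (λ _ → false) A
      constant _ _ _ _ = agreeing λ ()

      capped : ∀ {t M} → M ∈ₛ A → TopStable L t A M → lookup (f x) i ≡ t i → lookup (f x) i ≡ b
      capped {t} {M} M∈A top e = trans e (trans (sym (TopStable.caps top M∈A (agreeing λ ()) x≤M refl e)) (value M∈A))
        where
        x≤M : Below L t x M
        x≤M = below λ {k} _ e′ → bool-stable λ ne → not-¬ e′ (Hull.inherits hullA k _ λ a∈A →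
          ¬-not λ e″ → ne (Below.rise (top-is-max L attA M∈A top a∈A) refl e″))

      by-extremes : ∀ {t} → Extremes L t A → lookup (f x) i ≡ b
      by-extremes {t} ((M , M∈A , top) , (m , m∈A , bot)) with lookup (f x) i ≟ᵇ t i
      ... | yes e = capped M∈A top e
      ... | no ne = capped m∈A bot (¬-not ne)

      by-fixed : ∀ {r} → r ∈ₛ A → Fixed L r → lookup (f x) i ≡ b
      by-fixed r∈A fixed = trans (local-Q L (agreeing λ ()) x≈r refl) (trans (fixed i refl) (value r∈A))
        where
        x≈r : Agree (λ _ → true) x _
        x≈r = agreeing λ {k} _ → Hull.inherits hullA k _ λ a∈A →
          on (fixed-constant L attA constant r∈A fixed a∈A) refl

-- Spans and the two conclusions

span-hull : {A : CSet n} (S : Subspace n) (x : Config n) → IsSpan A S → x ∈ₚ S → Hull A x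
span-hull {n} {A = A} S x (_ , least) x∈S = hull λ k b value →
  -- The subspace fixing only coordinate `k` contains `A`, hence also `S`, and thus `x`.
  least (replicate n nothing [ k ]≔ just b)
    (λ a a∈A i c e → slot k b value a∈A i c e (i ≟ k)) x x∈S k b (lookup∘update k (replicate n nothing) _)
  where
  slot : ∀ k b → (∀ {a} → a ∈ₛ A → lookup a k ≡ b) → ∀ {a} → a ∈ₛ A → ∀ i c →
    lookup (replicate n nothing [ k ]≔ just b) i ≡ just c → Dec (i ≡ k) → lookup a i ≡ c
  slot k b value a∈A i c e (yes refl) =
    trans (value a∈A) (just-injective (trans (sym (lookup∘update k (replicate n nothing) _)) e))
  slot k b value a∈A i c e (no i≢k) = contradiction
    (trans (sym (trans (lookup∘update′ i≢k (replicate n nothing) _) (lookup-replicate i nothing))) e) λ ()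

theorem33 : ∀ (n : ℕ) (G : SignedDigraph n) →
    (AtMostOneNegCycle G → SeparatingG G) ×
    (StronglyConnected G → AtMostOneNegCycle G → TrappingG G)
theorem33 n G = separating , λ strong unique f inF → separating unique f inF ,
    λ A attA S T spanS trapT →
      (λ x → proj₂ spanS T (proj₁ (proj₂ trapT)) x) ,
      (λ x → proj₂ (proj₂ trapT) S (span-trap strong unique f inF A attA S spanS) (proj₁ spanS) x)
  where
  separating : AtMostOneNegCycle G → SeparatingG G
  separating unique f inF A B attA attB A≢B S T spanS spanT x (x∈S , x∈T) =
    hulls-meet⇒equal (λ {j} {i} {s} → Equivalence.from (inF j i s)) unique attA attB
      (span-hull S x spanS x∈S) (span-hull T x spanT x∈T) A≢B

  span-trap : StronglyConnected G → AtMostOneNegCycle G → ∀ f → InF G f →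
    ∀ A → Attractor f A → ∀ S → IsSpan A S → TrapSpace f S
  span-trap strong unique f inF A attA S spanS x i x∈S ne k b Sk with k ≟ i
  ... | no k≢i = trans (flip-off x k≢i) (x∈S k b Sk)
  -- `S` fixes `k`, so `A` is constant there and `hull-closed` gives `f x` the value that `x`
  -- already has: no move at `k` exists.
  ... | yes refl = contradiction
          (trans (hull-closed (λ {j} {i} {s} → Equivalence.from (inF j i s)) unique strong attA
            (span-hull S x spanS x∈S) λ {a} a∈A → proj₁ spanS a a∈A k b Sk) (sym (x∈S k b Sk))) ne
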